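{- Let $c>0$ be a constant, let $F$ be a 3-CNF formula with $N$ variables and $M\le cN$ clauses, and let $k\ge2$ be an integer. Partition the clauses of $F$ arbitrarily into $k$ groups $\mathcal C_1,\dots,\mathcal C_k$, each containing at most $\lceil M/k\rceil$ clauses, and let $X_i$ be the set of variables appearing in the clauses of $\mathcal C_i$. Let $G_F$ be the $k$-partite graph with pairwise disjoint color classes $V_1,\dots,V_k$, where $V_i$ consists of all local assignments $\sigma_i:X_i\to\{0,1\}$ that satisfy every clause in $\mathcal C_i$, and where, for $i\ne j$, $\sigma_i\in V_i$ and $\sigma_j\in V_j$ are adjacent if and only if they agree on their common variables: \[ \sigma_i|_{X_i\cap X_j}=\sigma_j|_{X_i\cap X_j}. \] Then $F$ is satisfiable if and only if $G_F$ contains a multicolored $k$-clique.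
   Context: A multicolored $k$-clique in a $k$-partite graph with color classes $V_1,\dots,V_k$ is a clique $\{x_1,\dots,x_k\}$ with $x_i\in V_i$ for every $i$. Assignments belonging to different classes $V_i$ are regarded as distinct vertices even if they coincide as functions; there are no edges inside a class. -}

module Defs where

open import Data.Bool using (Bool)
open import Data.Fin using (Fin; _≟_)
open import Data.Fin.Subset using (Subset; _∈_; _⊆_; _∩_; ⁅_⁆; ⋃)
open import Data.Fin.Subset.Properties using (p∩q⊆p; p∩q⊆q; x∈p∩q⁺; x∈p∩q⁻)
open import Data.Integer as ℤ using (+_)
open import Data.List using (List; allFin; filter; length; map)
open import Data.List.Relation.Unary.All using (All)
open import Data.List.Relation.Unary.Any using (Any)
open import Data.Nat using (ℕ; NonZero; _≤_)
open import Data.Product using (Σ; ∃; _×_; _,_; proj₁; swap)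
open import Data.Rational as ℚ using (ℚ; 0ℚ; ceiling)
open import Data.Refinement using (Refinement; value)
open import Data.Sum using (_⊎_)
open import Data.Vec using (Vec; lookup)
open import Data.Vec.Properties.WithK using ([]=-irrelevant)
import Data.Vec.Relation.Unary.All as Vec
open import Function using (_∘_; _⇔_)
open import Level using (0ℓ)
open import Relation.Binary using (Rel; Symmetric)
open import Relation.Binary.PropositionalEquality using (_≡_; _≢_; cong; sym; module ≡-Reasoning)
open import Relation.Nullary using (¬_)

-- Dedekind real numbers: `Lower q` means q < x and `Upper q` means x < q.
record ℝ : Set₁ where
  field
    Lower Upper     : ℚ → Set
    lower-inhabited : ∃ Lower
    upper-inhabited : ∃ Upper
    lower-rounded   : ∀ q → Lower q ⇔ ∃ λ r → q ℚ.< r × Lower r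
    upper-rounded   : ∀ r → Upper r ⇔ ∃ λ q → q ℚ.< r × Upper q
    disjoint        : ∀ q → ¬ (Lower q × Upper q)
    located         : ∀ q r → q ℚ.< r → Lower q ⊎ Upper r

Positive : ℝ → Set
Positive x = ℝ.Lower x 0ℚ

-- m ≤ x n for a real x: since n ≥ 0, the product x n is the infimum of q n over
-- the rationals q > x.
_≤_·_ : ℕ → ℝ → ℕ → Set
m ≤ x · n = ∀ q → ℝ.Upper x q → (+ m ℚ./ 1) ℚ.≤ q ℚ.* (+ n ℚ./ 1)

record Literal (N : ℕ) : Set where
  constructor literal
  field
    var  : Fin N
    sign : Bool  -- true for the variable itself, false for its negation

open Literal public

-- A clause has at most three literals; repetitions are allowed.
record Clause (N : ℕ) : Set where
  constructor clause
  field
    literals : List (Literal N)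
    width≤3  : length literals ≤ 3

open Clause public

3-CNF : (N M : ℕ) → Set
3-CNF N M = Vec (Clause N) M

Satisfiable : ∀ {N M} → 3-CNF N M → Set
Satisfiable {N} F = ∃ λ (α : Fin N → Bool) →
  Vec.All (λ C → Any (λ ℓ → α (var ℓ) ≡ sign ℓ) (literals C)) F

Assignment : ∀ {N} → Subset N → Set
Assignment X = ∀ v → v ∈ X → Bool

_↾_ : ∀ {N} {X Y : Subset N} → Assignment X → Y ⊆ X → Assignment Y
(σ ↾ Y⊆X) v v∈Y = σ v (Y⊆X v∈Y)

_≗ₐ_ : ∀ {N} {X : Subset N} → Assignment X → Assignment X → Set
σ ≗ₐ τ = ∀ v v∈X → σ v v∈X ≡ τ v v∈X

_⊨_ : ∀ {N} {X : Subset N} → Assignment X → Clause N → Set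
_⊨_ {X = X} σ C =
  Any (λ ℓ → Σ (var ℓ ∈ X) λ v∈X → σ (var ℓ) v∈X ≡ sign ℓ) (literals C)

clauseVars : ∀ {N} → Clause N → Subset N
clauseVars = ⋃ ∘ map (⁅_⁆ ∘ var) ∘ literals

-- A partition of M clauses into k (possibly empty) groups, given by the group
-- index of each clause.
Partition : (M k : ℕ) → Set
Partition M k = Fin M → Fin k

module _ {N M k : ℕ} (F : 3-CNF N M) (π : Partition M k) where

  group : Fin k → List (Clause N)
  group i = map (lookup F) (filter (λ m → π m ≟ i) (allFin M))

  Balanced : .{{_ : NonZero k}} → Set
  Balanced = ∀ i → + length (group i) ℤ.≤ ceiling (+ M ℚ./ k)

  groupVars : Fin k → Subset N
  groupVars i = ⋃ (map clauseVars (group i))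

  -- The satisfaction proof is irrelevant, so a vertex is just an assignment.
  LocalAssignment : Fin k → Set
  LocalAssignment i =
    Refinement (Assignment (groupVars i)) (λ σ → All (σ ⊨_) (group i))

  Agree : ∀ {i j} → LocalAssignment i → LocalAssignment j → Set
  Agree {i} {j} σ τ =
    (value σ ↾ p∩q⊆p (groupVars i) (groupVars j)) ≗ₐ
    (value τ ↾ p∩q⊆q (groupVars i) (groupVars j))

-- The vertex set is the disjoint union of the colour classes.
record PartiteGraph (k : ℕ) : Set₁ where
  field
    Class       : Fin k → Set
    _~_         : Rel (Σ (Fin k) Class) 0ℓ
    ~-sym       : Symmetric _~_
    independent : ∀ {u v} → u ~ v → proj₁ u ≢ proj₁ v

MulticoloredClique : ∀ {k} → PartiteGraph k → Set
MulticoloredClique {k} G = Σ (∀ i → Class i) λ x →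
  ∀ i j → i ≢ j → (i , x i) ~ (j , x j)
  where open PartiteGraph G

module _ {N M k : ℕ} (F : 3-CNF N M) (π : Partition M k) where

  agree-sym : ∀ {i j} (σ : LocalAssignment F π i) (τ : LocalAssignment F π j) →
              Agree F π σ τ → Agree F π τ σ
  agree-sym {i} {j} σ τ σ≗τ v v∈Xⱼ∩Xᵢ = begin
    value τ v (p∩q⊆p Xⱼ Xᵢ v∈Xⱼ∩Xᵢ)  ≡⟨ cong (value τ v) ([]=-irrelevant _ _) ⟩
    value τ v (p∩q⊆q Xᵢ Xⱼ v∈Xᵢ∩Xⱼ)  ≡⟨ σ≗τ v v∈Xᵢ∩Xⱼ ⟨
    value σ v (p∩q⊆p Xᵢ Xⱼ v∈Xᵢ∩Xⱼ)  ≡⟨ cong (value σ v) ([]=-irrelevant _ _) ⟩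
    value σ v (p∩q⊆q Xⱼ Xᵢ v∈Xⱼ∩Xᵢ)  ∎
    where
    open ≡-Reasoning
    Xᵢ = groupVars F π i
    Xⱼ = groupVars F π j
    v∈Xᵢ∩Xⱼ = x∈p∩q⁺ (swap (x∈p∩q⁻ Xⱼ Xᵢ v∈Xⱼ∩Xᵢ))

  assignmentGraph : PartiteGraph k
  assignmentGraph = record
    { Class       = LocalAssignment F π
    ; _~_         = λ (i , σ) (j , τ) → i ≢ j × Agree F π σ τ
    ; ~-sym       = λ {(_ , σ)} {(_ , τ)} (i≢j , σ≗τ) → i≢j ∘ sym , agree-sym σ τ σ≗τ
    ; independent = λ (i≢j , _) → i≢j
    }

{-# OPTIONS --safe #-}
module Submission where

open import Defs
open import Data.Bool using (Bool; false)
import Data.Bool as Bool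
open import Data.Fin using (Fin; _≟_)
open import Data.Fin.Properties using (any?)
open import Data.Fin.Subset using (Subset; _∈_; ⋃; ⁅_⁆)
open import Data.Fin.Subset.Properties
  using (_∈?_; x∈⁅x⁆; p⊆p∪q; q⊆p∪q; x∈p∩q⁺)
open import Data.Irrelevant using ([_])
open import Data.List using (_∷_)
open import Data.List.Membership.Propositional using (find; lose) renaming (_∈_ to _∈ₗ_)
open import Data.List.Membership.Propositional.Properties
  using (∈-map⁺; ∈-map⁻; ∈-filter⁺; ∈-allFin)
open import Data.List.Relation.Unary.All as All using (All)
open import Data.List.Relation.Unary.Any as Any using (Any; here; there)
open import Data.Nat using (ℕ; NonZero; _≤_)
open import Data.Product using (∃; _,_; proj₂)
open import Data.Refinement using (value; proof; _,_)
open import Data.Vec using (lookup)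
open import Data.Vec.Properties.WithK using ([]=-irrelevant)
import Data.Vec.Relation.Unary.All as Vec
import Data.Vec.Relation.Unary.All.Properties as Vec
open import Function using (_∘_; _⇔_; mk⇔)
open import Relation.Binary.PropositionalEquality using (_≡_; _≢_; refl; trans; cong)
open import Relation.Nullary using (Dec; yes; no; contradiction; recompute)

-- Local solutions that are pairwise compatible glue to a global one. The restrictions of a
-- satisfying assignment to the sets `groupVars F π i` are vertices and agree on overlaps, hence
-- form a clique (`satisfiable⇒clique`). Conversely, the members of a clique give each variable at
-- most one value (`value-unique`), so a single assignment extends them all (`glue-extends`). Every
-- clause lies in some group, and the chosen vertex of that group already makes it true
-- (`glue-satisfies`).

⋃⁺ : ∀ {n} {x : Fin n} {p : Subset n} {ps} → p ∈ₗ ps → x ∈ p → x ∈ ⋃ ps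
⋃⁺ {ps = _ ∷ ps} (here refl)  x∈p = p⊆p∪q (⋃ ps) x∈p
⋃⁺ {ps = q ∷ ps} (there p∈ps) x∈p = q⊆p∪q q (⋃ ps) (⋃⁺ p∈ps x∈p)

var∈clauseVars : ∀ {N} (C : Clause N) {ℓ} → ℓ ∈ₗ literals C → var ℓ ∈ clauseVars C
var∈clauseVars _ {ℓ} ℓ∈C = ⋃⁺ (∈-map⁺ (⁅_⁆ ∘ var) ℓ∈C) (x∈⁅x⁆ (var ℓ))

Satisfies : ∀ {N} → (Fin N → Bool) → Clause N → Set
Satisfies α C = Any (λ ℓ → α (var ℓ) ≡ sign ℓ) (literals C)

satisfies? : ∀ {N} (α : Fin N → Bool) C → Dec (Satisfies α C)
satisfies? α C = Any.any? (λ ℓ → α (var ℓ) Bool.≟ sign ℓ) (literals C)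

module _ {N M k : ℕ} (F : 3-CNF N M) (π : Partition M k) where

  lookup∈group : ∀ m → lookup F m ∈ₗ group F π (π m)
  lookup∈group m = ∈-map⁺ (lookup F) (∈-filter⁺ (λ m′ → π m′ ≟ π m) (∈-allFin m) refl)

  clauseVars⊆groupVars : ∀ {i C v} → C ∈ₗ group F π i → v ∈ clauseVars C → v ∈ groupVars F π i
  clauseVars⊆groupVars C∈Cᵢ = ⋃⁺ (∈-map⁺ clauseVars C∈Cᵢ)

  -- Local satisfaction also demands that the variable of the true literal lie in the domain; it
  -- does, since the clause belongs to the group.
  restriction-satisfies : ∀ {α} → Vec.All (Satisfies α) F → ∀ i →
    All (_⊨_ {X = groupVars F π i} (λ v _ → α v)) (group F π i)
  restriction-satisfies {α} α⊨F i = All.tabulate satisfied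
    where
    satisfied : ∀ {C} → C ∈ₗ group F π i → _⊨_ {X = groupVars F π i} (λ v _ → α v) C
    satisfied C∈Cᵢ with ∈-map⁻ (lookup F) C∈Cᵢ
    ... | m , _ , refl with find (Vec.lookup⁺ α⊨F m)
    ...   | ℓ , ℓ∈C , αℓ = lose ℓ∈C
      (clauseVars⊆groupVars C∈Cᵢ (var∈clauseVars (lookup F m) ℓ∈C) , αℓ)

  satisfiable⇒clique : Satisfiable F → MulticoloredClique (assignmentGraph F π)
  satisfiable⇒clique (α , α⊨F) =
    (λ i → (λ v _ → α v) , [ restriction-satisfies α⊨F i ]) ,
    -- Both restrictions compute to the same value of `α`.
    (λ _ _ i≢j → i≢j , λ _ _ → refl)

  module _ (x : ∀ i → LocalAssignment F π i) where

    glueAt : ∀ {v} → Dec (∃ λ i → v ∈ groupVars F π i) → Bool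
    glueAt (yes (i , v∈Xᵢ)) = value (x i) _ v∈Xᵢ
    -- A variable in no group occurs in no clause, so its value is arbitrary.
    glueAt (no _)           = false

    glue : Fin N → Bool
    glue v = glueAt (any? λ i → v ∈? groupVars F π i)

    module _ (agree : ∀ i j → i ≢ j → Agree F π (x i) (x j)) where

      -- Adjacency covers only distinct classes. Within one class the two values could differ only
      -- through the membership proof, and such proofs are unique; the same uniqueness matches the
      -- proofs that `Agree` obtains from the intersection.
      value-unique : ∀ {i j v} (v∈Xᵢ : v ∈ groupVars F π i) (v∈Xⱼ : v ∈ groupVars F π j) →
                     value (x i) v v∈Xᵢ ≡ value (x j) v v∈Xⱼ
      value-unique {i} {j} {v} v∈Xᵢ v∈Xⱼ with i ≟ j
      ... | yes refl = cong (value (x i) v) ([]=-irrelevant _ _)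
      ... | no i≢j   = trans (cong (value (x i) v) ([]=-irrelevant _ _))
        (trans (agree i j i≢j v (x∈p∩q⁺ (v∈Xᵢ , v∈Xⱼ)))
               (cong (value (x j) v) ([]=-irrelevant _ _)))

      glue-extends : ∀ {i v} (v∈Xᵢ : v ∈ groupVars F π i) → glue v ≡ value (x i) v v∈Xᵢ
      glue-extends {i} {v} v∈Xᵢ with any? (λ i → v ∈? groupVars F π i)
      -- The group found by the search need not be `i`.
      ... | yes (_ , v∈Xⱼ) = value-unique v∈Xⱼ v∈Xᵢ
      ... | no v∉          = contradiction (i , v∈Xᵢ) v∉

      glue-⊨ : ∀ {i} C → value (x i) ⊨ C → Satisfies glue C
      glue-⊨ _ = Any.map λ (v∈Xᵢ , σℓ) → trans (glue-extends v∈Xᵢ) σℓ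

      -- Vertices carry only irrelevant satisfaction proofs; decidability of
      -- clause satisfaction makes them usable.
      glue-satisfies : ∀ m → Satisfies glue (lookup F m)
      glue-satisfies m with proof (x (π m))
      ... | [ σ⊨Cᵢ ] = recompute (satisfies? glue (lookup F m))
        (glue-⊨ (lookup F m) (All.lookup σ⊨Cᵢ (lookup∈group m)))

  clique⇒satisfiable : MulticoloredClique (assignmentGraph F π) → Satisfiable F
  clique⇒satisfiable (x , adjacent) =
    glue x , Vec.lookup⁻ (glue-satisfies x λ i j i≢j → proj₂ (adjacent i j i≢j))

lemma6p1 : (c : ℝ) → Positive c →
    (N M : ℕ) → M ≤ c · N → (F : 3-CNF N M) →
    (k : ℕ) .{{_ : NonZero k}} → 2 ≤ k →
    (π : Partition M k) → Balanced F π →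
    Satisfiable F ⇔ MulticoloredClique (assignmentGraph F π)
lemma6p1 _ _ _ _ _ F _ _ π _ = mk⇔ (satisfiable⇒clique F π) (clique⇒satisfiable F π)
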